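{- Over $\mathrm{HA}^\omega+\mathrm{BI}$, the dependent explicitly controlled product of quantifiers $\mathsf{EPQ}$ is $T$-definable from Spector's general bar recursion $\mathsf{BR}$; that is, $\mathsf{BR}\geq_T\mathsf{EPQ}$.
   Context: Types and systems. Finite types are generated from $\mathbb{B}$ (booleans) and $\mathbb{N}$ by $X\times Y$, $X\to Y$ and $X^*$ (finite sequences). For a sequence of types $(X_i)_{i\in\mathbb{N}}$, $\Pi_i X_i$ is the type of infinite sequences whose $i$-th entry is in $X_i$ and $\Pi_{i<n}X_i$ the type of finite sequences of length $n$. (This is used for readability; one may take all $X_i$ equal to one type $X$, reading $\Pi_iX_i$ as $\mathbb{N}\to X$ and finite sequence types as $X^*$.) $\mathrm{HA}^\omega$ is Heyting arithmetic in all finite types with fully extensional equality (Troelstra's E-$\mathrm{HA}^\omega$); system $T$ is its quantifier-free fragment (Gödel's primitive recursive functionals). $\mathbf{0}$ denotes the canonical zero object of each type (the zero sequence for sequence types). Notation. $*$ is concatenation; $|s|$ is the length of $s$; $q_s(\alpha)=q(s*\alpha)$, $q_x=q_{\langle x\rangle}$. $K_RX=(X\to R)\to R$. $T$-definability. A functional is specified by a defining equation (for each choice of type parameters). $G$ is $T$-definable from $F$ over a theory $\mathcal{S}$ (written $F\ge_T G$) if for each choice of types for $G$ there are a choice of types for $F$ and a term $s$ of system $T$ such that $s(F)$ satisfies the defining equation of $G$, provably in $\mathcal{S}$ together with the defining equation of $F$. In both definitions $\phi\colon\Pi_k(\Pi_{i<k}X_i\to K_RX_k)$, so $\phi_s\colon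 K_RX_{|s|}$ for $s\colon\Pi_{i<|s|}X_i$. $\mathsf{BR}$. For $q\colon\Pi_iX_i\to R$, $\omega\colon\Pi_iX_i\to\mathbb{N}$, the value $\mathsf{BR}^\omega_s(\phi)(q)\colon R$ is specified by: $\mathsf{BR}^\omega_s(\phi)(q)=q_s(\mathbf{0})$ if $\omega_s(\mathbf{0})<|s|$, and otherwise $\mathsf{BR}^\omega_s(\phi)(q)=\phi_s(\lambda x^{X_{|s|}}.\,\mathsf{BR}^\omega_{s*x}(\phi)(q))$. $\mathsf{EPQ}$. For $q\colon\Pi_iX_{|s|+i}\to R$, $\ell\colon R\to\mathbb{N}$, the value $\mathsf{EPQ}^\ell_s(\phi)(q)\colon R$ is specified by: $\mathsf{EPQ}^\ell_s(\phi)(q)=q(\mathbf{0})$ if $\ell(q(\mathbf{0}))<|s|$, and otherwise $\mathsf{EPQ}^\ell_s(\phi)(q)=\phi_s(\lambda x^{X_{|s|}}.\,\mathsf{EPQ}^\ell_{s*x}(\phi)(q_x))$. $\mathrm{BI}$ (relativised bar induction) is the scheme, for arbitrary predicates $S,P$ on finite sequences: if $S(\langle\rangle)$, and for every infinite $\alpha$ with $S([\alpha](n))$ for all $n$ there is $n$ with $P([\alpha](n))$, and for all $s$ with $S(s)$: $\forall x[S(s*x)\to P(s*x)]\to P(s)$; then $P(\langle\rangle)$. Here $[\alpha](n)=\langle\alpha(0),\dots,\alpha(n-1)\rangle$. -}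

module Defs where

open import Level using (0ℓ)
open import Data.List using (List; []; _∷_; map)
open import Data.List.Membership.Propositional using (_∈_)
open import Data.List.Relation.Binary.Subset.Propositional using (_⊆_)
open import Data.List.Relation.Unary.Any using (here; there)
open import Data.Product using (_×_; _,_; Σ-syntax)
open import Relation.Binary.PropositionalEquality using (refl)
open import Relation.Unary using (Pred; _∪_)

infixr 7 _⇒_
infixr 8 _⊗_
infix  9 _*

data Ty : Set where
  𝔹 ℕ̇     : Ty
  _⊗_ _⇒_ : Ty → Ty → Ty
  _*      : Ty → Ty

-- Families of types (Xᵢ)ᵢ are taken constant: Πᵢ Xᵢ is ℕ̇ ⇒ X, and all the
-- types of finite sequences Π_{i<n} Xᵢ are collected in X *.

Ctx : Set
Ctx = List Ty

-- Finite sequences are generated from ⟨⟩ by appending at the right end, so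
-- that s * x is a constructor form and seqrec recurses on initial segments.

data Const : Ty → Set where
  tt ff     : Const 𝔹
  cond      : ∀ {X} → Const (𝔹 ⇒ X ⇒ X ⇒ X)
  zero      : Const ℕ̇
  suc       : Const (ℕ̇ ⇒ ℕ̇)
  rec       : ∀ {X} → Const (X ⇒ (ℕ̇ ⇒ X ⇒ X) ⇒ ℕ̇ ⇒ X)
  pair      : ∀ {X Y} → Const (X ⇒ Y ⇒ X ⊗ Y)
  fst       : ∀ {X Y} → Const (X ⊗ Y ⇒ X)
  snd       : ∀ {X Y} → Const (X ⊗ Y ⇒ Y)
  nil       : ∀ {X} → Const (X *)
  snoc      : ∀ {X} → Const (X * ⇒ X ⇒ X *)
  seqrec    : ∀ {X Y} → Const (Y ⇒ (X * ⇒ X ⇒ Y ⇒ Y) ⇒ X * ⇒ Y)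

infixl 20 _·_

data Tm (Γ : Ctx) : Ty → Set where
  var : ∀ {X} → X ∈ Γ → Tm Γ X
  con : ∀ {X} → Const X → Tm Γ X
  lam : ∀ {X Y} → Tm (X ∷ Γ) Y → Tm Γ (X ⇒ Y)
  _·_ : ∀ {X Y} → Tm Γ (X ⇒ Y) → Tm Γ X → Tm Γ Y

liftᵣ : ∀ {Γ Δ : Ctx} {X} → Γ ⊆ Δ → X ∷ Γ ⊆ X ∷ Δ
liftᵣ ρ (here p)  = here p
liftᵣ ρ (there i) = there (ρ i)

ren : ∀ {Γ Δ : Ctx} {X} → Γ ⊆ Δ → Tm Γ X → Tm Δ X
ren ρ (var i) = var (ρ i)
ren ρ (con c) = con c
ren ρ (lam t) = lam (ren (liftᵣ ρ) t)
ren ρ (t · u) = ren ρ t · ren ρ u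

wk : ∀ {Γ X Y} → Tm Γ X → Tm (Y ∷ Γ) X
wk = ren there

Sub : Ctx → Ctx → Set
Sub Γ Δ = ∀ {X} → X ∈ Γ → Tm Δ X

infixl 5 _▸_

_▸_ : ∀ {Γ Δ X} → Sub Γ Δ → Tm Δ X → Sub (X ∷ Γ) Δ
(σ ▸ t) (here refl) = t
(σ ▸ t) (there i)   = σ i

liftₛ : ∀ {Γ Δ X} → Sub Γ Δ → Sub (X ∷ Γ) (X ∷ Δ)
liftₛ σ (here p)  = var (here p)
liftₛ σ (there i) = wk (σ i)

sub : ∀ {Γ Δ X} → Sub Γ Δ → Tm Γ X → Tm Δ X
sub σ (var i) = σ i
sub σ (con c) = con c
sub σ (lam t) = lam (sub (liftₛ σ) t)
sub σ (t · u) = sub σ t · sub σ u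

_[_] : ∀ {Γ X Y} → Tm (X ∷ Γ) Y → Tm Γ X → Tm Γ Y
t [ u ] = sub (var ▸ u) t

v₀ : ∀ {Γ A} → Tm (A ∷ Γ) A
v₀ = var (here refl)

v₁ : ∀ {Γ A B} → Tm (B ∷ A ∷ Γ) A
v₁ = wk v₀

v₂ : ∀ {Γ A B C} → Tm (C ∷ B ∷ A ∷ Γ) A
v₂ = wk v₁

v₃ : ∀ {Γ A B C D} → Tm (D ∷ C ∷ B ∷ A ∷ Γ) A
v₃ = wk v₂

v₄ : ∀ {Γ A B C D E} → Tm (E ∷ D ∷ C ∷ B ∷ A ∷ Γ) A
v₄ = wk v₃

-- 𝟎 (ℕ̇ ⇒ X) is the zero infinite sequence; 𝟎 (X *) is ⟨⟩.
𝟎 : ∀ {Γ} (X : Ty) → Tm Γ X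
𝟎 𝔹       = con ff
𝟎 ℕ̇       = con zero
𝟎 (X ⊗ Y) = con pair · 𝟎 X · 𝟎 Y
𝟎 (X ⇒ Y) = lam (𝟎 Y)
𝟎 (X *)   = con nil

⟨⟩ : ∀ {Γ X} → Tm Γ (X *)
⟨⟩ = con nil

infixl 19 _∗_

_∗_ : ∀ {Γ X} → Tm Γ (X *) → Tm Γ X → Tm Γ (X *)
s ∗ x = con snoc · s · x

positive : ∀ {Γ} → Tm Γ (ℕ̇ ⇒ 𝔹)
positive = con rec · con ff · lam (lam (con tt))

pred : ∀ {Γ} → Tm Γ (ℕ̇ ⇒ ℕ̇)
pred = con rec · con zero · lam (lam v₁)

-- λ n m. n ∸ m
monus : ∀ {Γ} → Tm Γ (ℕ̇ ⇒ ℕ̇ ⇒ ℕ̇)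
monus = lam (con rec · v₀ · lam (lam (pred · v₀)))

-- λ m n. (m < n), the truth value of n ∸ m > 0.
lt : ∀ {Γ} → Tm Γ (ℕ̇ ⇒ ℕ̇ ⇒ 𝔹)
lt = lam (lam (positive · (monus · v₀ · v₁)))

len : ∀ {Γ X} → Tm Γ (X * ⇒ ℕ̇)
len = con seqrec · con zero · lam (lam (lam (con suc · v₀)))

-- λ x α. ⟨ x , α 0 , α 1 , … ⟩
prefix : ∀ {Γ X} → Tm Γ (X ⇒ (ℕ̇ ⇒ X) ⇒ ℕ̇ ⇒ X)
prefix = lam (lam (con rec · v₁ · lam (lam (v₂ · v₁))))

-- λ s α. s * α, by ⟨⟩ * α = α and (s * x) * α = s * (x * α).
concat : ∀ {Γ X} → Tm Γ (X * ⇒ (ℕ̇ ⇒ X) ⇒ ℕ̇ ⇒ X)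
concat = con seqrec · lam v₀ · lam (lam (lam (lam (v₁ · (prefix · v₂ · v₀)))))

-- λ q s. qₛ, where qₛ (α) = q (s * α).
section : ∀ {Γ X R} → Tm Γ (((ℕ̇ ⇒ X) ⇒ R) ⇒ X * ⇒ (ℕ̇ ⇒ X) ⇒ R)
section = lam (lam (lam (v₂ · (concat · v₁ · v₀))))

-- λ α n. [α](n) = ⟨ α 0 , … , α (n - 1) ⟩
initial : ∀ {Γ X} → Tm Γ ((ℕ̇ ⇒ X) ⇒ ℕ̇ ⇒ X *)
initial = lam (con rec · ⟨⟩ · lam (lam (v₀ ∗ (v₂ · v₁))))

infix  6 _≈_
infixr 5 _∧̇_
infixr 4 _∨̇_
infixr 3 _⊃_

data Fm (Γ : Ctx) : Set where
  ⊥̇           : Fm Γ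
  _≈_         : ∀ {X} → Tm Γ X → Tm Γ X → Fm Γ
  _∧̇_ _∨̇_ _⊃_ : Fm Γ → Fm Γ → Fm Γ
  ∀̇ ∃̇         : (X : Ty) → Fm (X ∷ Γ) → Fm Γ

renF : ∀ {Γ Δ} → Γ ⊆ Δ → Fm Γ → Fm Δ
renF ρ ⊥̇       = ⊥̇
renF ρ (t ≈ u) = ren ρ t ≈ ren ρ u
renF ρ (A ∧̇ B) = renF ρ A ∧̇ renF ρ B
renF ρ (A ∨̇ B) = renF ρ A ∨̇ renF ρ B
renF ρ (A ⊃ B) = renF ρ A ⊃ renF ρ B
renF ρ (∀̇ X A) = ∀̇ X (renF (liftᵣ ρ) A)
renF ρ (∃̇ X A) = ∃̇ X (renF (liftᵣ ρ) A)

wkF : ∀ {Γ X} → Fm Γ → Fm (X ∷ Γ)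
wkF = renF there

subF : ∀ {Γ Δ} → Sub Γ Δ → Fm Γ → Fm Δ
subF σ ⊥̇       = ⊥̇
subF σ (t ≈ u) = sub σ t ≈ sub σ u
subF σ (A ∧̇ B) = subF σ A ∧̇ subF σ B
subF σ (A ∨̇ B) = subF σ A ∨̇ subF σ B
subF σ (A ⊃ B) = subF σ A ⊃ subF σ B
subF σ (∀̇ X A) = ∀̇ X (subF (liftₛ σ) A)
subF σ (∃̇ X A) = ∃̇ X (subF (liftₛ σ) A)

_[_]F : ∀ {Γ X} → Fm (X ∷ Γ) → Tm Γ X → Fm Γ
A [ u ]F = subF (var ▸ u) A

-- A ⟨ t / ρ ⟩ is A(t), in a context extending that of the parameters of A.
_⟨_/_⟩ : ∀ {Γ Δ X} → Fm (X ∷ Γ) → Tm Δ X → Γ ⊆ Δ → Fm Δ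
A ⟨ t / ρ ⟩ = subF ((λ i → var (ρ i)) ▸ t) A

Theory : Set₁
Theory = ∀ {Γ} → Pred (Fm Γ) 0ℓ

infix 2 _⨾_⊢_

data _⨾_⊢_ (𝒮 : Theory) {Γ : Ctx} (Φ : List (Fm Γ)) : Fm Γ → Set where
  axiom : ∀ {A} → 𝒮 A → 𝒮 ⨾ Φ ⊢ A
  hyp   : ∀ {A} → A ∈ Φ → 𝒮 ⨾ Φ ⊢ A
  ⊥E    : ∀ {A} → 𝒮 ⨾ Φ ⊢ ⊥̇ → 𝒮 ⨾ Φ ⊢ A
  ∧I    : ∀ {A B} → 𝒮 ⨾ Φ ⊢ A → 𝒮 ⨾ Φ ⊢ B → 𝒮 ⨾ Φ ⊢ A ∧̇ B
  ∧E₁   : ∀ {A B} → 𝒮 ⨾ Φ ⊢ A ∧̇ B → 𝒮 ⨾ Φ ⊢ A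
  ∧E₂   : ∀ {A B} → 𝒮 ⨾ Φ ⊢ A ∧̇ B → 𝒮 ⨾ Φ ⊢ B
  ∨I₁   : ∀ {A B} → 𝒮 ⨾ Φ ⊢ A → 𝒮 ⨾ Φ ⊢ A ∨̇ B
  ∨I₂   : ∀ {A B} → 𝒮 ⨾ Φ ⊢ B → 𝒮 ⨾ Φ ⊢ A ∨̇ B
  ∨E    : ∀ {A B C} → 𝒮 ⨾ Φ ⊢ A ∨̇ B →
          𝒮 ⨾ A ∷ Φ ⊢ C → 𝒮 ⨾ B ∷ Φ ⊢ C → 𝒮 ⨾ Φ ⊢ C
  ⊃I    : ∀ {A B} → 𝒮 ⨾ A ∷ Φ ⊢ B → 𝒮 ⨾ Φ ⊢ A ⊃ B
  ⊃E    : ∀ {A B} → 𝒮 ⨾ Φ ⊢ A ⊃ B → 𝒮 ⨾ Φ ⊢ A → 𝒮 ⨾ Φ ⊢ B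
  ∀I    : ∀ {X A} → 𝒮 ⨾ map wkF Φ ⊢ A → 𝒮 ⨾ Φ ⊢ ∀̇ X A
  ∀E    : ∀ {X A} → 𝒮 ⨾ Φ ⊢ ∀̇ X A → (t : Tm Γ X) → 𝒮 ⨾ Φ ⊢ A [ t ]F
  ∃I    : ∀ {X A} (t : Tm Γ X) → 𝒮 ⨾ Φ ⊢ A [ t ]F → 𝒮 ⨾ Φ ⊢ ∃̇ X A
  ∃E    : ∀ {X A C} → 𝒮 ⨾ Φ ⊢ ∃̇ X A →
          𝒮 ⨾ A ∷ map wkF Φ ⊢ wkF C → 𝒮 ⨾ Φ ⊢ C

-- E-HA^ω, with equality a primitive congruence at every type and
-- extensionality as an axiom.

data HAω {Γ : Ctx} : Fm Γ → Set where
  ≈-refl  : ∀ {X} (t : Tm Γ X) → HAω (t ≈ t)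
  ≈-subst : ∀ {X} (A : Fm (X ∷ Γ)) (t u : Tm Γ X) →
            HAω (t ≈ u ⊃ A [ t ]F ⊃ A [ u ]F)
  ext     : ∀ {X Y} (f g : Tm Γ (X ⇒ Y)) →
            HAω (∀̇ X (wk f · v₀ ≈ wk g · v₀) ⊃ f ≈ g)

  β           : ∀ {X Y} (t : Tm (X ∷ Γ) Y) (u : Tm Γ X) →
                HAω (lam t · u ≈ t [ u ])
  cond-tt     : ∀ {X} (t u : Tm Γ X) → HAω (con cond · con tt · t · u ≈ t)
  cond-ff     : ∀ {X} (t u : Tm Γ X) → HAω (con cond · con ff · t · u ≈ u)
  rec-zero    : ∀ {X} (a : Tm Γ X) f → HAω (con rec · a · f · con zero ≈ a)
  rec-suc     : ∀ {X} (a : Tm Γ X) f n →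
                HAω (con rec · a · f · (con suc · n) ≈
                     f · n · (con rec · a · f · n))
  fst-pair    : ∀ {X Y} (t : Tm Γ X) (u : Tm Γ Y) →
                HAω (con fst · (con pair · t · u) ≈ t)
  snd-pair    : ∀ {X Y} (t : Tm Γ X) (u : Tm Γ Y) →
                HAω (con snd · (con pair · t · u) ≈ u)
  pair-η      : ∀ {X Y} (p : Tm Γ (X ⊗ Y)) →
                HAω (con pair · (con fst · p) · (con snd · p) ≈ p)
  seqrec-nil  : ∀ {X Y} (a : Tm Γ Y) (f : Tm Γ (X * ⇒ X ⇒ Y ⇒ Y)) →
                HAω (con seqrec · a · f · ⟨⟩ ≈ a)
  seqrec-snoc : ∀ {X Y} (a : Tm Γ Y) (f : Tm Γ (X * ⇒ X ⇒ Y ⇒ Y)) s x →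
                HAω (con seqrec · a · f · (s ∗ x) ≈
                     f · s · x · (con seqrec · a · f · s))

  suc≉zero : ∀ n → HAω (con suc · n ≈ con zero ⊃ ⊥̇)
  suc-inj  : ∀ m n → HAω (con suc · m ≈ con suc · n ⊃ m ≈ n)

  𝔹-ind : ∀ (A : Fm (𝔹 ∷ Γ)) → HAω (A [ con tt ]F ⊃ A [ con ff ]F ⊃ ∀̇ 𝔹 A)
  ℕ-ind : ∀ (A : Fm (ℕ̇ ∷ Γ)) →
          HAω (A [ con zero ]F ⊃
               ∀̇ ℕ̇ (A ⊃ A ⟨ con suc · v₀ / there ⟩) ⊃
               ∀̇ ℕ̇ A)
  *-ind : ∀ {X} (A : Fm (X * ∷ Γ)) →
          HAω (A [ ⟨⟩ ]F ⊃
               ∀̇ (X *) (A ⊃ ∀̇ X (A ⟨ v₁ ∗ v₀ / (λ i → there (there i)) ⟩)) ⊃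
               ∀̇ (X *) A)

data BI {Γ : Ctx} : Fm Γ → Set where
  bar-ind : ∀ {X} (S P : Fm (X * ∷ Γ)) →
    BI (S [ ⟨⟩ ]F ⊃
        ∀̇ (ℕ̇ ⇒ X)
          (∀̇ ℕ̇ (S ⟨ initial · v₁ · v₀ / (λ i → there (there i)) ⟩) ⊃
           ∃̇ ℕ̇ (P ⟨ initial · v₁ · v₀ / (λ i → there (there i)) ⟩)) ⊃
        ∀̇ (X *)
          (S ⊃
           ∀̇ X (S ⟨ v₁ ∗ v₀ / (λ i → there (there i)) ⟩ ⊃
                P ⟨ v₁ ∗ v₀ / (λ i → there (there i)) ⟩) ⊃
           P) ⊃
        P [ ⟨⟩ ]F)

HAω+BI : Theory
HAω+BI = HAω ∪ BI

-- The functional being specified is the single free variable of its equation.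
record Specification : Set₁ where
  field
    Parameters : Set
    type       : Parameters → Ty
    equation   : (p : Parameters) → Fm (type p ∷ [])

open Specification

-- 𝒮 ⊩ F ≥ᵀ G: for each choice p of types for G there are a choice of types
-- for F and a closed term s such that 𝒮, with F a free variable assumed to
-- satisfy its own equation, proves the equation of G for s · F.  The schemata
-- of 𝒮 may mention this variable.
_⊩_≥ᵀ_ : Theory → Specification → Specification → Set
𝒮 ⊩ F ≥ᵀ G =
  (p : Parameters G) →
  Σ[ p′ ∈ Parameters F ] Σ[ s ∈ Tm [] (type F p′ ⇒ type G p) ]
    (𝒮 ⨾ equation F p′ ∷ [] ⊢
       equation G p ⟨ ren (λ ()) s · v₀ / (λ ()) ⟩)

K : Ty → Ty → Ty
K R X = (X ⇒ R) ⇒ R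

-- Argument order: BR · ω · s · φ · q.
BR : Specification
BR = record
  { Parameters = Ty × Ty
  ; type = λ (X , R) →
      ((ℕ̇ ⇒ X) ⇒ ℕ̇) ⇒ X * ⇒ (X * ⇒ K R X) ⇒ ((ℕ̇ ⇒ X) ⇒ R) ⇒ R
  ; equation = λ (X , R) →
      ∀̇ ((ℕ̇ ⇒ X) ⇒ ℕ̇) (∀̇ (X *) (∀̇ (X * ⇒ K R X) (∀̇ ((ℕ̇ ⇒ X) ⇒ R)
        (let F = v₄ ; ω = v₃ ; s = v₂ ; φ = v₁ ; q = v₀ in
         F · ω · s · φ · q ≈
           con cond · (lt · (section · ω · s · 𝟎 (ℕ̇ ⇒ X)) · (len · s))
             · (section · q · s · 𝟎 (ℕ̇ ⇒ X))
             · (φ · s · lam (wk F · wk ω · (wk s ∗ v₀) · wk φ · wk q))))))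
  }

-- Argument order: EPQ · ℓ · s · φ · q.  Here q takes only the part of the
-- infinite sequence that follows s.
EPQ : Specification
EPQ = record
  { Parameters = Ty × Ty
  ; type = λ (X , R) →
      (R ⇒ ℕ̇) ⇒ X * ⇒ (X * ⇒ K R X) ⇒ ((ℕ̇ ⇒ X) ⇒ R) ⇒ R
  ; equation = λ (X , R) →
      ∀̇ (R ⇒ ℕ̇) (∀̇ (X *) (∀̇ (X * ⇒ K R X) (∀̇ ((ℕ̇ ⇒ X) ⇒ R)
        (let F = v₄ ; ℓ = v₃ ; s = v₂ ; φ = v₁ ; q = v₀ in
         F · ℓ · s · φ · q ≈
           con cond · (lt · (ℓ · (q · 𝟎 (ℕ̇ ⇒ X))) · (len · s))
             · (q · 𝟎 (ℕ̇ ⇒ X))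
             · (φ · s ·
                lam (wk F · wk ℓ · (wk s ∗ v₀) · wk φ
                       · (section · wk q · (⟨⟩ ∗ v₀))))))))
  }

-- EPQ_s(φ)(q) is computed by BR started at s, with q and the control function
-- ℓ ∘ q reading only the part of their argument that follows s.  To unfold its
-- equation one must replace these two functionals by the ones belonging to
-- s * x, which agree with them on the extensions of s * x only.  That BR_s
-- depends on its arguments through their values at extensions of s follows by
-- bar induction.  The bar is reached by Kreisel's argument: bar recursion also
-- defines a counter for the length of the path from s along any given α, and
-- a finite counter value cannot decrease forever.  Both uses of BR are combined
-- by taking the result type R ⊗ (ℕ̇ ⇒ ℕ̇).

module Submission where

open import Defs
open import Data.List using (List; []; _∷_; map)
open import Data.List.Membership.Propositional using (_∈_)
open import Data.List.Relation.Binary.Subset.Propositional using (_⊆_)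
open import Data.List.Relation.Unary.Any using (here; there)
open import Data.Nat using (ℕ; zero; suc)
open import Data.Product using (_,_; Σ-syntax; proj₁; proj₂)
open import Data.Sum using (inj₁; inj₂)
open import Relation.Binary.PropositionalEquality
  using (_≡_; refl; sym; trans; cong; cong₂; subst; subst₂)

v₅ : ∀ {Γ A B C D E G} → Tm (G ∷ E ∷ D ∷ C ∷ B ∷ A ∷ Γ) A
v₅ = wk v₄

v₆ : ∀ {Γ A B C D E G H} → Tm (H ∷ G ∷ E ∷ D ∷ C ∷ B ∷ A ∷ Γ) A
v₆ = wk v₅

v₇ : ∀ {Γ A B C D E G H I} → Tm (I ∷ H ∷ G ∷ E ∷ D ∷ C ∷ B ∷ A ∷ Γ) A
v₇ = wk v₆

v₈ : ∀ {Γ A B C D E G H I J} → Tm (J ∷ I ∷ H ∷ G ∷ E ∷ D ∷ C ∷ B ∷ A ∷ Γ) A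
v₈ = wk v₇

v₉ : ∀ {Γ A B C D E G H I J K} → Tm (K ∷ J ∷ I ∷ H ∷ G ∷ E ∷ D ∷ C ∷ B ∷ A ∷ Γ) A
v₉ = wk v₈

pattern 0ʰ = here refl
pattern 1ʰ = there 0ʰ
pattern 2ʰ = there 1ʰ
pattern 3ʰ = there 2ʰ
pattern 4ʰ = there 3ʰ

infix 2 _⊢ᴮ_

_⊢ᴮ_ : ∀ {Γ} → List (Fm Γ) → Fm Γ → Set
Φ ⊢ᴮ A = HAω+BI ⨾ Φ ⊢ A

-- Renaming, substitution and the zero objects.

sub-ren-inverse : ∀ {Γ Δ X} {ρ : Γ ⊆ Δ} {σ : Sub Δ Γ} →
  (∀ {Y} (i : Y ∈ Γ) → σ (ρ i) ≡ var i) → (t : Tm Γ X) → sub σ (ren ρ t) ≡ t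
sub-ren-inverse {Γ} {ρ = ρ} {σ} h = go
  where
  lifted : ∀ {Y Z} (i : Z ∈ Y ∷ Γ) → liftₛ σ (liftᵣ ρ i) ≡ var i
  lifted (here p)  = refl
  lifted (there i) = cong wk (h i)

  go : ∀ {X} (t : Tm Γ X) → sub σ (ren ρ t) ≡ t
  go (var i) = h i
  go (con c) = refl
  go (lam t) = cong lam (sub-ren-inverse lifted t)
  go (t · u) = cong₂ _·_ (go t) (go u)

wk-sub : ∀ {Γ X Y} (u : Tm Γ Y) (t : Tm Γ X) → wk t [ u ] ≡ t
wk-sub u = sub-ren-inverse (λ _ → refl)

ren-𝟎 : ∀ {Γ Δ} (ρ : Γ ⊆ Δ) X → ren ρ (𝟎 X) ≡ 𝟎 X
ren-𝟎 ρ 𝔹       = refl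
ren-𝟎 ρ ℕ̇       = refl
ren-𝟎 ρ (X ⊗ Y) = cong₂ (λ t u → con pair · t · u) (ren-𝟎 ρ X) (ren-𝟎 ρ Y)
ren-𝟎 ρ (X ⇒ Y) = cong lam (ren-𝟎 (liftᵣ ρ) Y)
ren-𝟎 ρ (X *)   = refl

sub-𝟎 : ∀ {Γ Δ} (σ : Sub Γ Δ) X → sub σ (𝟎 X) ≡ 𝟎 X
sub-𝟎 σ 𝔹       = refl
sub-𝟎 σ ℕ̇       = refl
sub-𝟎 σ (X ⊗ Y) = cong₂ (λ t u → con pair · t · u) (sub-𝟎 σ X) (sub-𝟎 σ Y)
sub-𝟎 σ (X ⇒ Y) = cong lam (sub-𝟎 (liftₛ σ) Y)
sub-𝟎 σ (X *)   = refl

-- Equational logic inside the theory.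

module _ {Γ : Ctx} {Φ : List (Fm Γ)} where

  ha : ∀ {A} → HAω A → Φ ⊢ᴮ A
  ha a = axiom (inj₁ a)

  rfl : ∀ {X} {t : Tm Γ X} → Φ ⊢ᴮ t ≈ t
  rfl = ha (≈-refl _)

  replace : ∀ {X} (A : Fm (X ∷ Γ)) {t u : Tm Γ X} →
            Φ ⊢ᴮ t ≈ u → Φ ⊢ᴮ A [ t ]F → Φ ⊢ᴮ A [ u ]F
  replace A e p = ⊃E (⊃E (ha (≈-subst A _ _)) e) p

  symm : ∀ {X} {t u : Tm Γ X} → Φ ⊢ᴮ t ≈ u → Φ ⊢ᴮ u ≈ t
  symm {t = t} {u} e =
    subst (λ t′ → Φ ⊢ᴮ u ≈ t′) (wk-sub u t)
      (replace (v₀ ≈ wk t) e (subst (λ t′ → Φ ⊢ᴮ t ≈ t′) (sym (wk-sub t t)) rfl))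

  infixr 4 _⨟_
  _⨟_ : ∀ {X} {t u w : Tm Γ X} → Φ ⊢ᴮ t ≈ u → Φ ⊢ᴮ u ≈ w → Φ ⊢ᴮ t ≈ w
  _⨟_ {t = t} {u} {w} d e =
    subst (λ t′ → Φ ⊢ᴮ t′ ≈ w) (wk-sub w t)
      (replace (wk t ≈ v₀) e (subst (λ t′ → Φ ⊢ᴮ t′ ≈ u) (sym (wk-sub u t)) d))

  cong-[] : ∀ {X Y} (C : Tm (X ∷ Γ) Y) {t u : Tm Γ X} →
            Φ ⊢ᴮ t ≈ u → Φ ⊢ᴮ C [ t ] ≈ C [ u ]
  cong-[] C {t} {u} e =
    subst (λ l → Φ ⊢ᴮ l ≈ C [ u ]) (wk-sub u (C [ t ]))
      (replace (wk (C [ t ]) ≈ C) e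
        (subst (λ l → Φ ⊢ᴮ l ≈ C [ t ]) (sym (wk-sub t (C [ t ]))) rfl))

  infixl 20 _⊙_
  _⊙_ : ∀ {X Y} {f g : Tm Γ (X ⇒ Y)} {t u : Tm Γ X} →
        Φ ⊢ᴮ f ≈ g → Φ ⊢ᴮ t ≈ u → Φ ⊢ᴮ f · t ≈ g · u
  _⊙_ {f = f} {g} {t} {u} d e =
    subst₂ (λ l r → Φ ⊢ᴮ f · l ≈ g · r) (wk-sub f t) (wk-sub g t)
      (cong-[] (v₀ · wk t) d)
    ⨟ subst₂ (λ l r → Φ ⊢ᴮ l · t ≈ r · u) (wk-sub t g) (wk-sub u g)
      (cong-[] (wk g · v₀) e)

-- Derived from `ext`: applied to a fresh variable, both abstractions β-reduce to their bodies, up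
-- to a renaming that the substitution undoes.
ξ : ∀ {Γ Φ X Y} {t u : Tm (X ∷ Γ) Y} →
    map wkF Φ ⊢ᴮ t ≈ u → Φ ⊢ᴮ lam t ≈ lam u
ξ {Γ} {Φ} {X} e = ⊃E (ha (ext _ _)) (∀I (open-β _ ⨟ e ⨟ symm (open-β _)))
  where
  v₀-inverse : ∀ {Z} (i : Z ∈ X ∷ Γ) → (var ▸ v₀) (liftᵣ there i) ≡ var i
  v₀-inverse (here refl) = refl
  v₀-inverse (there i)   = refl

  open-β : ∀ {Y} (t : Tm (X ∷ Γ) Y) → map wkF Φ ⊢ᴮ wk (lam t) · v₀ ≈ t
  open-β t = subst (λ t′ → map wkF Φ ⊢ᴮ wk (lam t) · v₀ ≈ t′)
               (sub-ren-inverse v₀-inverse t) (ha (β _ _))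

-- Equality proofs by evaluation of terms.

Reduct : ∀ {Γ X} → Tm Γ X → Set
Reduct {Γ} {X} t = Σ[ u ∈ Tm Γ X ] (∀ {Φ} → Φ ⊢ᴮ t ≈ u)

contract : ∀ {Γ X Y} (t : Tm Γ (X ⇒ Y)) (u : Tm Γ X) → Reduct (t · u)
contract (lam t) u                               = _ , ha (β t u)
contract (con cond · con tt · t) u               = _ , ha (cond-tt t u)
contract (con cond · con ff · t) u               = _ , ha (cond-ff t u)
contract (con rec · a · f) (con zero)            = _ , ha (rec-zero a f)
contract (con rec · a · f) (con suc · n)         = _ , ha (rec-suc a f n)
contract (con fst) (con pair · t · u)            = _ , ha (fst-pair t u)
contract (con snd) (con pair · t · u)            = _ , ha (snd-pair t u)
contract (con seqrec · a · f) (con nil)          = _ , ha (seqrec-nil a f)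
contract (con seqrec · a · f) (con snoc · s · x) = _ , ha (seqrec-snoc a f s x)
contract t u                                     = _ , rfl

develop : ∀ {Γ X} (t : Tm Γ X) → Reduct t
develop (var i) = _ , rfl
develop (con c) = _ , rfl
develop (lam t) with develop t
... | t′ , e = lam t′ , ξ e
develop (t · u) with develop t | develop u
... | t′ , d | u′ , e with contract t′ u′
... | w , c = w , (d ⊙ e ⨟ c)

-- n rounds of contracting all redexes at once; the result need not be normal.
normal : ∀ {Γ X} → ℕ → (t : Tm Γ X) → Reduct t
normal zero    t = t , rfl
normal (suc n) t with develop t
... | t′ , d with normal n t′
... | t″ , e = t″ , (d ⨟ e)

nf : ∀ {Γ X} → Tm Γ X → Tm Γ X
-- Any number of rounds is sound; twelve let the two sides meet in every use below.
nf t = proj₁ (normal 12 t)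

reduces : ∀ {Γ X Φ} (t : Tm Γ X) → Φ ⊢ᴮ t ≈ nf t
reduces t = proj₂ (normal 12 t)

-- Proof by reflection: each contraction carries its own derivation, so a syntactic identity checked
-- by Agda becomes a theorem of the theory.
by-computation : ∀ {Γ X Φ} {t u : Tm Γ X} → nf t ≡ nf u → Φ ⊢ᴮ t ≈ u
by-computation {Φ = Φ} {t} {u} e =
  subst (λ w → Φ ⊢ᴮ t ≈ w) e (reduces t) ⨟ symm (reduces u)

convert : ∀ {Γ X Φ} {t t′ u u′ : Tm Γ X} →
          Φ ⊢ᴮ t ≈ u → nf t ≡ nf t′ → nf u ≡ nf u′ → Φ ⊢ᴮ t′ ≈ u′
convert e p q = by-computation (sym p) ⨟ e ⨟ by-computation q

-- Operations on sequences and conditionals.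

append : ∀ {Γ X} → Tm Γ (X * ⇒ X * ⇒ X *)
append = lam (con seqrec · v₀ · lam (lam (lam (v₀ ∗ v₁))))

drop : ∀ {Γ X} → Tm Γ (X * ⇒ (ℕ̇ ⇒ X) ⇒ ℕ̇ ⇒ X)
drop = con seqrec · lam v₀ · lam (lam (lam (lam (lam (v₂ · v₁ · (con suc · v₀))))))

-- The infinite sequence stays quantified in the induction: at `s ∗ x` the hypothesis is used for
-- `prefix · x · α`, and the shift by `suc` in `drop` then removes `x`.
drop-concat : ∀ {Γ Φ X} →
  Φ ⊢ᴮ ∀̇ {Γ} (X *) (∀̇ (ℕ̇ ⇒ X) (drop · v₁ · (concat · v₁ · v₀) ≈ v₀))
drop-concat {X = X} =
  ⊃E (⊃E (ha (*-ind (∀̇ (ℕ̇ ⇒ X) (drop · v₁ · (concat · v₁ · v₀) ≈ v₀))))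
    (∀I (by-computation refl)))
    (∀I (⊃I (∀I (∀I (⊃E (ha (ext _ _)) (∀I
      (convert (∀E (hyp 0ʰ) (prefix · v₂ · v₁) ⊙ rfl {t = con suc · v₀}) refl refl)))))))

bool-cases : ∀ {Γ Φ} (b : Tm Γ 𝔹) → Φ ⊢ᴮ b ≈ con tt ∨̇ b ≈ con ff
bool-cases b = ∀E (⊃E (⊃E (ha (𝔹-ind (v₀ ≈ con tt ∨̇ v₀ ≈ con ff))) (∨I₁ rfl)) (∨I₂ rfl)) b

fst-cond : ∀ {Γ Φ X Y} →
  Φ ⊢ᴮ ∀̇ {Γ} (X ⊗ Y) (∀̇ (X ⊗ Y) (∀̇ 𝔹
         (con fst · (con cond · v₀ · v₂ · v₁) ≈
          con cond · v₀ · (con fst · v₂) · (con fst · v₁))))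
fst-cond = ∀I (∀I (⊃E (⊃E (ha (𝔹-ind _)) (by-computation refl)) (by-computation refl)))

-- Stopping condition and defining equations.

stops : ∀ {Γ X} → Tm Γ ((ℕ̇ ⇒ X) ⇒ ℕ̇) → Tm Γ (X *) → Tm Γ (ℕ̇ ⇒ X) → Tm Γ 𝔹
stops ω s z = lt · (section · ω · s · z) · (len · s)

BRType : Ty → Ty → Ty
BRType X R = ((ℕ̇ ⇒ X) ⇒ ℕ̇) ⇒ X * ⇒ (X * ⇒ K R X) ⇒ ((ℕ̇ ⇒ X) ⇒ R) ⇒ R

-- 𝟎 X does not compute under substitution for a variable X, so the equations
-- are stated and used for an arbitrary sequence z in the place of 𝟎.
BREquationAt : ∀ {Γ X R} → Tm Γ (BRType X R) →
  Tm (((ℕ̇ ⇒ X) ⇒ R) ∷ (X * ⇒ K R X) ∷ X * ∷ ((ℕ̇ ⇒ X) ⇒ ℕ̇) ∷ Γ) (ℕ̇ ⇒ X) →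
  Fm Γ
BREquationAt {X = X} {R} F z =
  ∀̇ ((ℕ̇ ⇒ X) ⇒ ℕ̇) (∀̇ (X *) (∀̇ (X * ⇒ K R X) (∀̇ ((ℕ̇ ⇒ X) ⇒ R)
    (let F = wk (wk (wk (wk F)))
         ω = v₃ ; s = v₂ ; φ = v₁ ; q = v₀ in
     F · ω · s · φ · q ≈
       con cond · stops ω s z
         · (section · q · s · z)
         · (φ · s · lam (wk F · wk ω · (wk s ∗ v₀) · wk φ · wk q))))))

BREquation : ∀ {Γ X R} → Tm Γ (BRType X R) → Tm Γ (ℕ̇ ⇒ X) → Fm Γ
BREquation F z = BREquationAt F (wk (wk (wk (wk z))))

EPQType : Ty → Ty → Ty
EPQType X R = (R ⇒ ℕ̇) ⇒ X * ⇒ (X * ⇒ K R X) ⇒ ((ℕ̇ ⇒ X) ⇒ R) ⇒ R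

EPQEquationAt : ∀ {Γ X R} → Tm Γ (EPQType X R) →
  Tm (((ℕ̇ ⇒ X) ⇒ R) ∷ (X * ⇒ K R X) ∷ X * ∷ (R ⇒ ℕ̇) ∷ Γ) (ℕ̇ ⇒ X) →
  Fm Γ
EPQEquationAt {X = X} {R} F z =
  ∀̇ (R ⇒ ℕ̇) (∀̇ (X *) (∀̇ (X * ⇒ K R X) (∀̇ ((ℕ̇ ⇒ X) ⇒ R)
    (let F = wk (wk (wk (wk F)))
         ℓ = v₃ ; s = v₂ ; φ = v₁ ; q = v₀ in
     F · ℓ · s · φ · q ≈
       con cond · (lt · (ℓ · (q · z)) · (len · s))
         · (q · z)
         · (φ · s ·
            lam (wk F · wk ℓ · (wk s ∗ v₀) · wk φ
                   · (section · wk q · (⟨⟩ ∗ v₀))))))))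

EPQEquation : ∀ {Γ X R} → Tm Γ (EPQType X R) → Tm Γ (ℕ̇ ⇒ X) → Fm Γ
EPQEquation F z = EPQEquationAt F (wk (wk (wk (wk z))))

-- Kreisel's counter: every path meets the stopping condition.

module _ {X R : Ty} where

  private
    Q : Ty
    Q = R ⊗ (ℕ̇ ⇒ ℕ̇)

  -- The numerical argument of the second component is the position in α, so
  -- that no arithmetic with |s| is needed to follow α beyond s.
  counter : ∀ {Γ} (r : Tm Γ R) (α : Tm Γ (ℕ̇ ⇒ X)) → Tm Γ (X * ⇒ K Q X)
  counter r α = lam (lam (con pair · wk (wk r) ·
    lam (con suc · (con snd · (v₁ · (wk (wk (wk α)) · v₀)) · (con suc · v₀)))))

  none : ∀ {Γ} (r : Tm Γ R) → Tm Γ ((ℕ̇ ⇒ X) ⇒ Q)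
  none r = lam (con pair · wk r · lam (con zero))

  along : ∀ {Γ} → Tm Γ (X *) → Tm Γ (ℕ̇ ⇒ X) → Tm Γ ℕ̇ → Tm Γ (X *)
  along s α n = append · s · (initial · α · n)

  -- The bar for `locality`, found by induction on the counter value at position 0. `r` supplies the
  -- element of `R` that the pairs in `Q` require.
  stops-along : ∀ {Γ Φ} → Φ ⊢ᴮ
    ∀̇ {Γ} (BRType X Q) (∀̇ (ℕ̇ ⇒ X) (BREquation v₁ v₀ ⊃
      ∀̇ R (∀̇ ((ℕ̇ ⇒ X) ⇒ ℕ̇) (∀̇ (X *) (∀̇ (ℕ̇ ⇒ X)
        (∃̇ ℕ̇ (stops v₃ (along v₂ v₁ v₀) v₅ ≈ con tt)))))))
  stops-along = ∀I (∀I (⊃I (∀I (∀I (∀I (∀I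
      (⊃E (∀E (∀E count (value v₅ v₂ v₁ v₃ v₀ (con zero))) (con zero)) rfl)))))))
    where
    value : ∀ {Γ} → Tm Γ (BRType X Q) → Tm Γ ((ℕ̇ ⇒ X) ⇒ ℕ̇) → Tm Γ (X *) →
            Tm Γ R → Tm Γ (ℕ̇ ⇒ X) → Tm Γ ℕ̇ → Tm Γ ℕ̇
    value F ω s r α n =
      con snd · (F · ω · along s α n · counter r α · none r) · n

    -- Where `F` does not stop, `counter` makes the recursive call at `along s α n ∗ α n`, which
    -- computes to `along s α (suc n)`.
    unwind : ∀ {Γ Φ} → BREquation v₅ v₄ ∷ Φ ⊢ᴮ
      ∀̇ {(ℕ̇ ⇒ X) ∷ X * ∷ ((ℕ̇ ⇒ X) ⇒ ℕ̇) ∷ R ∷ (ℕ̇ ⇒ X) ∷ BRType X Q ∷ Γ}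
        ℕ̇ (stops v₃ (along v₂ v₁ v₀) v₅ ≈ con ff ⊃
           value v₆ v₃ v₂ v₄ v₁ v₀ ≈
           con suc · value v₆ v₃ v₂ v₄ v₁ (con suc · v₀))
    unwind = ∀I (⊃I
      (rfl {t = con snd}
        ⊙ (∀E (∀E (∀E (∀E (hyp 1ʰ) v₃) (along v₂ v₁ v₀)) (counter v₄ v₁)) (none v₄)
           ⨟ rfl {t = con cond} ⊙ hyp 0ʰ ⊙ rfl ⊙ rfl)
        ⊙ rfl
       ⨟ by-computation refl))

    -- Induction on the counter value for all positions at once, since a decrease by one moves the
    -- position forward.
    count : ∀ {Γ Φ} → BREquation v₅ v₄ ∷ Φ ⊢ᴮ
      ∀̇ {(ℕ̇ ⇒ X) ∷ X * ∷ ((ℕ̇ ⇒ X) ⇒ ℕ̇) ∷ R ∷ (ℕ̇ ⇒ X) ∷ BRType X Q ∷ Γ}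
        ℕ̇ (∀̇ ℕ̇ (value v₇ v₄ v₃ v₅ v₂ v₀ ≈ v₁ ⊃
        ∃̇ ℕ̇ (stops v₅ (along v₄ v₃ v₀) v₇ ≈ con tt)))
    -- The cut turns `unwind` into a hypothesis, which is weakened automatically under the later
    -- quantifiers.
    count = ⊃E (⊃I (⊃E (⊃E (ha (ℕ-ind _)) base) (∀I (⊃I step)))) unwind
      where
      base = ∀I (⊃I (∨E (bool-cases (stops v₃ (along v₂ v₁ v₀) v₅))
        (∃I v₀ (hyp 0ʰ))
        (⊥E (⊃E (ha (suc≉zero _)) (symm (⊃E (∀E (hyp 2ʰ) v₀) (hyp 0ʰ)) ⨟ hyp 1ʰ)))))
      step = ∀I (⊃I (∨E (bool-cases (stops v₄ (along v₃ v₂ v₀) v₆))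
        (∃I v₀ (hyp 0ʰ))
        (⊃E (∀E (hyp 2ʰ) (con suc · v₀))
          (⊃E (ha (suc-inj _ _)) (symm (⊃E (∀E (hyp 3ʰ) v₀) (hyp 0ʰ)) ⨟ hyp 1ʰ)))))

  -- Dependence on values at extensions only.

  agree : ∀ {Γ Y} → Tm Γ ((ℕ̇ ⇒ X) ⇒ Y) → Tm Γ ((ℕ̇ ⇒ X) ⇒ Y) → Tm Γ (X *) → Fm Γ
  agree f g s = ∀̇ (ℕ̇ ⇒ X) (wk f · (concat · wk s · v₀) ≈ wk g · (concat · wk s · v₀))

  -- Bar induction starts at `⟨⟩`, so its predicates speak of the part `t` added to `s`: `agreement`
  -- relativises, `equality` is the conclusion.
  locality : ∀ {Γ Φ} → Φ ⊢ᴮ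
    ∀̇ {Γ} (BRType X Q) (∀̇ (ℕ̇ ⇒ X) (BREquation v₁ v₀ ⊃
      ∀̇ ((ℕ̇ ⇒ X) ⇒ ℕ̇) (∀̇ ((ℕ̇ ⇒ X) ⇒ ℕ̇) (∀̇ (X * ⇒ K Q X)
        (∀̇ ((ℕ̇ ⇒ X) ⇒ Q) (∀̇ ((ℕ̇ ⇒ X) ⇒ Q) (∀̇ (X *)
          (agree v₅ v₄ v₀ ⊃ agree v₂ v₁ v₀ ⊃
           v₇ · v₅ · v₀ · v₃ · v₂ ≈ v₇ · v₄ · v₀ · v₃ · v₁))))))))
  locality = ∀I (∀I (⊃I (∀I (∀I (∀I (∀I (∀I (∀I (⊃I (⊃I bar-induction))))))))))
    where
    Arguments : Ctx → Ctx
    Arguments Γ =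
      X * ∷ ((ℕ̇ ⇒ X) ⇒ Q) ∷ ((ℕ̇ ⇒ X) ⇒ Q) ∷ (X * ⇒ K Q X) ∷
      ((ℕ̇ ⇒ X) ⇒ ℕ̇) ∷ ((ℕ̇ ⇒ X) ⇒ ℕ̇) ∷ (ℕ̇ ⇒ X) ∷ BRType X Q ∷ Γ

    agreement equality : ∀ {Γ} → Fm (X * ∷ Arguments Γ)
    agreement = agree v₆ v₅ (append · v₁ · v₀) ∧̇ agree v₃ v₂ (append · v₁ · v₀)
    equality  = v₈ · v₆ · (append · v₁ · v₀) · v₄ · v₃ ≈
                v₈ · v₅ · (append · v₁ · v₀) · v₄ · v₂

    -- Agreement at `z` makes the second control function stop at the same node, where both sides
    -- reduce to values of the two output functionals at one sequence.
    at-bar : ∀ {Γ Φ A B} →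
      stops v₇ (along v₂ v₁ v₀) v₈ ≈ con tt ∷
      ∀̇ ℕ̇ (agree v₈ v₇ (along v₃ v₂ v₀) ∧̇ agree v₅ v₄ (along v₃ v₂ v₀)) ∷
      A ∷ B ∷ BREquation v₉ v₈ ∷ Φ ⊢ᴮ
      _≈_ {ℕ̇ ∷ (ℕ̇ ⇒ X) ∷ Arguments Γ}
        (v₉ · v₇ · along v₂ v₁ v₀ · v₅ · v₄) (v₉ · v₆ · along v₂ v₁ v₀ · v₅ · v₃)
    at-bar =
      ∀E (∀E (∀E (∀E (hyp 4ʰ) v₇) (along v₂ v₁ v₀)) v₅) v₄
      ⨟ rfl {t = con cond} ⊙ hyp 0ʰ ⊙ rfl ⊙ rfl
      ⨟ convert {u′ = v₃ · (concat · along v₂ v₁ v₀ · v₈)}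
          (∀E (∧E₂ (∀E (hyp 1ʰ) v₀)) v₈) refl refl
      ⨟ symm
        (∀E (∀E (∀E (∀E (hyp 4ʰ) v₆) (along v₂ v₁ v₀)) v₅) v₃
         ⨟ rfl {t = con cond}
             ⊙ (convert (rfl {t = lt} ⊙ symm (∀E (∧E₁ (∀E (hyp 1ʰ) v₀)) v₈)
                  ⊙ rfl {t = len · along v₂ v₁ v₀}) refl refl ⨟ hyp 0ʰ)
             ⊙ rfl ⊙ rfl
         ⨟ by-computation refl)

    -- Both sides are unfolded without deciding whether they stop: test, value and recursive branch
    -- are equated separately under `cond`.
    below-bar : ∀ {Γ Φ A B} →
      ∀̇ X (agree v₇ v₆ (append · v₂ · (v₁ ∗ v₀)) ∧̇ agree v₄ v₃ (append · v₂ · (v₁ ∗ v₀)) ⊃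
           v₉ · v₇ · (append · v₂ · (v₁ ∗ v₀)) · v₅ · v₄ ≈
           v₉ · v₆ · (append · v₂ · (v₁ ∗ v₀)) · v₅ · v₃) ∷
      agreement ∷ A ∷ B ∷ BREquation v₈ v₇ ∷ Φ ⊢ᴮ equality {Γ}
    below-bar =
      ∀E (∀E (∀E (∀E (hyp 4ʰ) v₆) (append · v₁ · v₀)) v₄) v₃
      ⨟ rfl {t = con cond}
          ⊙ convert (rfl {t = lt} ⊙ ∀E (∧E₁ (hyp 1ʰ)) v₇
               ⊙ rfl {t = len · (append · v₁ · v₀)}) refl refl
          ⊙ convert (∀E (∧E₂ (hyp 1ʰ)) v₇) refl refl
          ⊙ (rfl ⊙ ξ (convert (⊃E (∀E (hyp 0ʰ) v₀)
              -- Agreement passes from `t` to `t ∗ x` by instantiation at `prefix · x · α`.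
              (∧I (∀I (convert (∀E (∧E₁ (hyp 1ʰ)) (prefix · v₁ · v₀)) refl refl))
                  (∀I (convert (∀E (∧E₂ (hyp 1ʰ)) (prefix · v₁ · v₀)) refl refl))))
              refl refl))
      ⨟ symm (∀E (∀E (∀E (∀E (hyp 4ʰ) v₅) (append · v₁ · v₀)) v₄) v₂)

    bar-induction : ∀ {Γ Φ} →
      agree v₂ v₁ v₀ ∷ agree v₅ v₄ v₀ ∷ BREquation v₇ v₆ ∷ Φ ⊢ᴮ
      _≈_ {Arguments Γ} (v₇ · v₅ · v₀ · v₃ · v₂) (v₇ · v₄ · v₀ · v₃ · v₁)
    bar-induction =
      convert (⊃E (⊃E (⊃E (axiom (inj₂ (bar-ind agreement equality)))
        (∧I (∀I (convert (∀E (hyp 1ʰ) v₀) refl refl))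
            (∀I (convert (∀E (hyp 0ʰ) v₀) refl refl))))
        (∀I (⊃I (∃E
          (∀E (∀E (∀E (∀E (⊃E (∀E (∀E stops-along v₈) v₇) (hyp 3ʰ))
            -- An element of `R` is at hand as the first component of `q · z`.
            (con fst · (v₃ · v₇))) v₆) v₁) v₀)
          (∃I v₀ at-bar)))))
        (∀I (⊃I (⊃I below-bar))))
        refl refl

  -- The product of quantifiers from bar recursion.

  control : ∀ {Γ} → Tm Γ (R ⇒ ℕ̇) → Tm Γ (X *) → Tm Γ ((ℕ̇ ⇒ X) ⇒ R) →
            Tm Γ ((ℕ̇ ⇒ X) ⇒ ℕ̇)
  control ℓ s q = lam (wk ℓ · (wk q · (drop · wk s · v₀)))

  -- One `F` must serve both the product and the counter, hence the result type `Q`; here the second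
  -- component is constantly zero.
  pairedφ : ∀ {Γ} → Tm Γ (X * ⇒ K R X) → Tm Γ (X * ⇒ K Q X)
  pairedφ φ = lam (lam (con pair
    · (wk (wk φ) · v₁ · lam (con fst · (v₁ · v₀))) · lam (con zero)))

  pairedq : ∀ {Γ} → Tm Γ (X *) → Tm Γ ((ℕ̇ ⇒ X) ⇒ R) → Tm Γ ((ℕ̇ ⇒ X) ⇒ Q)
  pairedq s q = lam (con pair · (wk q · (drop · wk s · v₀)) · lam (con zero))

  product : ∀ {Γ} → Tm Γ (BRType X Q) → Tm Γ (R ⇒ ℕ̇) → Tm Γ (X *) →
            Tm Γ (X * ⇒ K R X) → Tm Γ ((ℕ̇ ⇒ X) ⇒ R) → Tm Γ Q
  product F ℓ s φ q = F · control ℓ s q · s · pairedφ φ · pairedq s q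

  realizer : Tm [] (BRType X Q ⇒ EPQType X R)
  realizer = lam (lam (lam (lam (lam (con fst · product v₄ v₃ v₂ v₁ v₀)))))

  realizes : ∀ {Γ Φ} → Φ ⊢ᴮ
    ∀̇ {Γ} (BRType X Q) (∀̇ (ℕ̇ ⇒ X) (BREquation v₁ v₀ ⊃
      EPQEquation (ren (λ ()) realizer · v₁) v₀))
  realizes = ∀I (∀I (⊃I (∀I (∀I (∀I (∀I
    ( by-computation {u = con fst · product v₅ v₃ v₂ v₁ v₀} refl
    ⨟ rfl ⊙ ∀E (∀E (∀E (∀E (hyp 0ʰ) (control v₃ v₂ v₀)) v₂) (pairedφ v₁)) (pairedq v₂ v₀)
    -- The projection moves into the branches, which can then be compared with those of the `EPQ`
    -- equation.
    ⨟ ∀E (∀E (∀E fst-cond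
        (section · pairedq v₂ v₀ · v₂ · v₄))
        (pairedφ v₁ · v₂ ·
          lam (v₆ · control v₄ v₃ v₁ · (v₃ ∗ v₀) · pairedφ v₂ · pairedq v₃ v₁)))
        (stops (control v₃ v₂ v₀) v₂ v₄)
    ⨟ convert
        (rfl {t = con cond}
          ⊙ (rfl {t = lt} ⊙ (rfl {t = v₃} ⊙ value-at-zero) ⊙ rfl {t = len · v₂})
          ⊙ value-at-zero
          ⊙ (rfl {t = v₁ · v₂} ⊙ ξ (rfl {t = con fst} ⊙ shift)))
        refl refl)))))))
    where
    value-at-zero : ∀ {Γ Φ} → Φ ⊢ᴮ
      _≈_ {((ℕ̇ ⇒ X) ⇒ R) ∷ (X * ⇒ K R X) ∷ X * ∷ (R ⇒ ℕ̇) ∷ (ℕ̇ ⇒ X) ∷ Γ}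
        (v₀ · (drop · v₂ · (concat · v₂ · v₄))) (v₀ · v₄)
    value-at-zero = rfl ⊙ ∀E (∀E drop-concat v₂) v₄

    tail : ∀ {Γ} → Tm (X ∷ ((ℕ̇ ⇒ X) ⇒ R) ∷ Γ) ((ℕ̇ ⇒ X) ⇒ R)
    tail = section · v₁ · (⟨⟩ ∗ v₀)

    -- Both sides equal `q` at `prefix · x · α`: dropping `s` leaves that sequence, while dropping
    -- `s ∗ x` leaves `α` and `tail` restores `x`.
    same-value : ∀ {Γ Φ} → Φ ⊢ᴮ
      _≈_ {(ℕ̇ ⇒ X) ∷ X ∷ ((ℕ̇ ⇒ X) ⇒ R) ∷ (X * ⇒ K R X) ∷ X * ∷ Γ}
        (v₂ · (drop · v₄ · (concat · (v₄ ∗ v₁) · v₀)))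
        (wk tail · (drop · (v₄ ∗ v₁) · (concat · (v₄ ∗ v₁) · v₀)))
    same-value =
      convert {u′ = v₂ · (prefix · v₁ · v₀)}
        (rfl {t = v₂} ⊙ ∀E (∀E drop-concat v₄) (prefix · v₁ · v₀)) refl refl
      ⨟ convert (rfl {t = wk tail} ⊙ symm (∀E (∀E drop-concat (v₄ ∗ v₁)) v₀)) refl refl

    -- This is `locality` at `s ∗ x`; the control and output functionals agree there by `same-value`
    -- under `ℓ` and under pairing.
    shift : ∀ {Γ Φ} →
      BREquation v₆ v₅ ∷ Φ ⊢ᴮ
      _≈_ {X ∷ ((ℕ̇ ⇒ X) ⇒ R) ∷ (X * ⇒ K R X) ∷ X * ∷ (R ⇒ ℕ̇) ∷ (ℕ̇ ⇒ X) ∷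
           BRType X Q ∷ Γ}
        (v₆ · control v₄ v₃ v₁ · (v₃ ∗ v₀) · pairedφ v₂ · pairedq v₃ v₁)
        (product v₆ v₄ (v₃ ∗ v₀) v₂ tail)
    shift = ⊃E (⊃E
      (∀E (∀E (∀E (∀E (∀E (∀E (⊃E (∀E (∀E locality v₆) v₅) (hyp 0ʰ))
        (control v₄ v₃ v₁)) (control v₄ (v₃ ∗ v₀) tail)) (pairedφ v₂))
        (pairedq v₃ v₁)) (pairedq (v₃ ∗ v₀) tail)) (v₃ ∗ v₀))
      (∀I (convert (rfl {t = v₅} ⊙ same-value) refl refl)))
      (∀I (convert (rfl {t = con pair} ⊙ same-value ⊙ rfl {t = lam (con zero)}) refl refl))

-- Instantiation at the zero sequence.

theorem3p16 : HAω+BI ⊩ BR ≥ᵀ EPQ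
theorem3p16 (X , R) = (X , R ⊗ (ℕ̇ ⇒ ℕ̇)) , realizer ,
  subst₂ (λ z z′ → BREquationAt v₀ z ∷ [] ⊢ᴮ EPQEquationAt (ren (λ ()) realizer · v₀) z′)
    -- The `EPQ` equation arises by substituting the realizer, so its zero sequence also carries a
    -- substitution.
    wk⁴-𝟎 (trans wk⁴-𝟎 (sym (sub-𝟎 _ (ℕ̇ ⇒ X))))
    (⊃E (∀E (∀E realizes v₀) (𝟎 (ℕ̇ ⇒ X))) (hyp 0ʰ))
  where
  wk-≡𝟎 : ∀ {Γ Y Z} {t : Tm Γ Y} → t ≡ 𝟎 Y → wk {Y = Z} t ≡ 𝟎 Y
  wk-≡𝟎 refl = ren-𝟎 there _

  wk⁴-𝟎 : ∀ {Γ A B C D Y} → wk (wk (wk (wk (𝟎 Y)))) ≡ 𝟎 {D ∷ C ∷ B ∷ A ∷ Γ} Y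
  wk⁴-𝟎 = wk-≡𝟎 (wk-≡𝟎 (wk-≡𝟎 (wk-≡𝟎 refl)))
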